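{- The Maximum Strong Transitivity Problem (MSTP) can be solved in linear time for split graphs. That is, MSTP restricted to input graphs $G=(V,E)$ that are split graphs is solvable by an algorithm with running time $O(|V|+|E|)$.
   Context: All graphs are finite, simple and undirected; $\deg_G(x)$ is the degree of $x$ in $G$. A graph is a split graph if its vertex set can be partitioned into an independent set $S$ and a clique $K$. For disjoint $A,B\subseteq V$, $A$ strongly dominates $B$ if for every $y\in B$ there is $x\in A$ with $xy\in E$ and $\deg_G(x)\ge \deg_G(y)$. A strong transitive partition of $G$ of order (size) $k$ is a partition $\{V_1,V_2,\ldots,V_k\}$ of $V$ into nonempty (ordered) parts such that $V_i$ strongly dominates $V_j$ for all $1\le i<j\le k$. The strong transitivity $Tr_{st}(G)$ is the maximum order of a strong transitive partition of $G$. MSTP is the optimization problem whose instance is a graph $G$, whose feasible solutions are the strong transitive partitions of $G$, and whose measure, to be maximized, is the order of the partition (so that the optimum value is $Tr_{st}(G)$). -}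

module Defs where

open import Data.Bool using (Bool; false; T; _∧_; if_then_else_)
open import Data.Fin using (Fin; toℕ)
import Data.Fin as Fin
open import Data.Fin.Subset using (Subset; _∈_; ∁)
open import Data.List
  using (List; allFin; cartesianProduct; concat; drop; filterᵇ; head; length; map; take)
open import Data.List.Relation.Binary.Permutation.Propositional using (_↭_)
open import Data.Maybe using (fromMaybe)
open import Data.Nat
  using (ℕ; suc; pred; _+_; _*_; _≤_; _<_; _≥_; _≮_; _<ᵇ_; _≡ᵇ_)
open import Data.Product using (∃-syntax; _×_; _,_)
open import Level using (0ℓ)
open import Relation.Binary.PropositionalEquality using (_≡_; _≢_)
open import Relation.Nullary using (¬_)
open import Relation.Unary using (Pred)

record Graph (n : ℕ) : Set where
  field
    adj    : Fin n → Fin n → Bool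
    sym    : ∀ x y → adj x y ≡ adj y x
    irrefl : ∀ x → adj x x ≡ false

  _~_ : Fin n → Fin n → Set
  x ~ y = T (adj x y)

  neighbours : Fin n → List (Fin n)
  neighbours x = filterᵇ (adj x) (allFin n)

  deg : Fin n → ℕ
  deg x = length (neighbours x)

  -- Each edge {x , y} is listed once, smaller endpoint first.
  edges : List (Fin n × Fin n)
  edges = filterᵇ (λ (x , y) → adj x y ∧ (toℕ x <ᵇ toℕ y))
                  (cartesianProduct (allFin n) (allFin n))

  ∣V∣ ∣E∣ : ℕ
  ∣V∣ = n
  ∣E∣ = length edges

module _ {n : ℕ} (G : Graph n) where
  open Graph G

  IsIndependent : Subset n → Set
  IsIndependent S = ∀ {x y} → x ∈ S → y ∈ S → ¬ (x ~ y)

  IsClique : Subset n → Set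
  IsClique K = ∀ {x y} → x ∈ K → y ∈ K → x ≢ y → x ~ y

  IsSplit : Set
  IsSplit = ∃[ S ] IsIndependent S × IsClique (∁ S)

  StronglyDominates : (A B : Pred (Fin n) 0ℓ) → Set
  StronglyDominates A B = ∀ y → B y → ∃[ x ] A x × x ~ y × deg x ≥ deg y

  -- The ordered partition V₁ , … , V_k is given by its classifying map;
  -- V_{i+1} is the fibre over i : Fin k.
  record StrongTransitivePartition (k : ℕ) : Set where
    field
      class : Fin n → Fin k

    Part : Fin k → Pred (Fin n) 0ℓ
    Part i x = class x ≡ i

    field
      nonempty  : ∀ i → ∃[ x ] Part i x
      dominates : ∀ {i j} → i Fin.< j → StronglyDominates (Part i) (Part j)

  -- k = Tr_st(G)
  IsStrongTransitivity : ℕ → Set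
  IsStrongTransitivity k =
    StrongTransitivePartition k × (∀ j → StrongTransitivePartition j → j ≤ k)

-- The machine model: a random access machine, programmed in while-programs
-- over natural-number registers and arrays with indirect addressing.
-- Arithmetic is limited to successor and predecessor and every operation is
-- charged, so in t steps no stored number can exceed the largest number in the
-- input or program by more than t.  Hence a linear-time computation only
-- handles words of O(log(|V| + |E|)) bits, and unit cost per operation is not
-- distorted by arithmetic on huge numbers.

Reg Arr : Set
Reg = ℕ
Arr = ℕ

data Exp : Set where
  lit     : ℕ → Exp
  reg     : Reg → Exp
  _⟦_⟧    : Arr → Exp → Exp
  inc dec : Exp → Exp

infix  6 _≺_
infix  5 _≔_ _⟦_⟧≔_
infixr 4 _⨾_

data Test : Set where
  _≺_ : Exp → Exp → Test

data Program : Set where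
  skip            : Program
  _≔_             : Reg → Exp → Program
  _⟦_⟧≔_          : Arr → Exp → Exp → Program
  _⨾_             : Program → Program → Program
  IF_THEN_ELSE_FI : Test → Program → Program → Program
  WHILE_DO_OD     : Test → Program → Program

record State : Set where
  constructor mkState
  field
    regs : Reg → ℕ
    arrs : Arr → ℕ → ℕ

open State public

_[_↦_] : {A : Set} → (ℕ → A) → ℕ → A → (ℕ → A)
(f [ i ↦ v ]) j = if j ≡ᵇ i then v else f j

setReg : Reg → ℕ → State → State
setReg r v s = mkState (regs s [ r ↦ v ]) (arrs s)

setArr : Arr → ℕ → ℕ → State → State
setArr a i v s = mkState (regs s) (arrs s [ a ↦ arrs s a [ i ↦ v ] ])

eval : Exp → State → ℕ
eval (lit k)   s = k
eval (reg r)   s = regs s r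
eval (a ⟦ e ⟧) s = arrs s a (eval e s)
eval (inc e)   s = suc (eval e s)
eval (dec e)   s = pred (eval e s)

cost : Exp → ℕ
cost (lit _)   = 1
cost (reg _)   = 1
cost (_ ⟦ e ⟧) = suc (cost e)
cost (inc e)   = suc (cost e)
cost (dec e)   = suc (cost e)

costᵗ : Test → ℕ
costᵗ (e₁ ≺ e₂) = suc (cost e₁ + cost e₂)

Holds Fails : Test → State → Set
Holds (e₁ ≺ e₂) s = eval e₁ s < eval e₂ s
Fails (e₁ ≺ e₂) s = eval e₁ s ≮ eval e₂ s

-- ⟨ p , s ⟩⇓⟨ s′ , t ⟩: started in state s, the program p halts in state s′
-- after exactly t steps.
data ⟨_,_⟩⇓⟨_,_⟩ : Program → State → State → ℕ → Set where
  ⇓skip  : ∀ {s} → ⟨ skip , s ⟩⇓⟨ s , 1 ⟩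
  ⇓reg   : ∀ {r e s} → ⟨ r ≔ e , s ⟩⇓⟨ setReg r (eval e s) s , suc (cost e) ⟩
  ⇓arr   : ∀ {a i e s} →
           ⟨ a ⟦ i ⟧≔ e , s ⟩⇓⟨ setArr a (eval i s) (eval e s) s , suc (cost i + cost e) ⟩
  ⇓seq   : ∀ {p q s s′ s″ t u} →
           ⟨ p , s ⟩⇓⟨ s′ , t ⟩ → ⟨ q , s′ ⟩⇓⟨ s″ , u ⟩ →
           ⟨ p ⨾ q , s ⟩⇓⟨ s″ , t + u ⟩
  ⇓then  : ∀ {b p q s s′ t} → Holds b s →
           ⟨ p , s ⟩⇓⟨ s′ , t ⟩ →
           ⟨ IF b THEN p ELSE q FI , s ⟩⇓⟨ s′ , costᵗ b + t ⟩
  ⇓else  : ∀ {b p q s s′ t} → Fails b s →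
           ⟨ q , s ⟩⇓⟨ s′ , t ⟩ →
           ⟨ IF b THEN p ELSE q FI , s ⟩⇓⟨ s′ , costᵗ b + t ⟩
  ⇓while : ∀ {b p s s′ s″ t u} → Holds b s →
           ⟨ p , s ⟩⇓⟨ s′ , t ⟩ → ⟨ WHILE b DO p OD , s′ ⟩⇓⟨ s″ , u ⟩ →
           ⟨ WHILE b DO p OD , s ⟩⇓⟨ s″ , costᵗ b + (t + u) ⟩
  ⇓done  : ∀ {b p s} → Fails b s →
           ⟨ WHILE b DO p OD , s ⟩⇓⟨ s , costᵗ b ⟩

record AdjacencyLists {n : ℕ} (G : Graph n) : Set where
  open Graph G
  field
    adjList : Fin n → List (Fin n)
    -- every neighbour occurs exactly once, in arbitrary order
    correct : ∀ x → adjList x ↭ neighbours x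

  -- Input layout: register 0 holds |V|.  Array 1 holds the adjacency lists of
  -- vertices 0 , 1 , … one after another; the list of vertex x occupies the
  -- cells array 0 [ x ] up to, but excluding, array 0 [ x + 1 ].  All other
  -- memory is zero.
  offset : ℕ → ℕ
  offset i = length (concat (take i (map adjList (allFin n))))

  entry : ℕ → ℕ
  entry j = fromMaybe 0 (head (drop j (map toℕ (concat (map adjList (allFin n))))))

  input : State
  input = mkState ((λ _ → 0) [ 0 ↦ n ])
                  (((λ _ _ → 0) [ 0 ↦ offset ]) [ 1 ↦ entry ])

open AdjacencyLists public using (input)

-- Output layout: register 0 holds the order of the partition, and array 2 maps
-- each vertex to the index, counted from 0, of the part containing it.
record OutputsMaximumSTP {n : ℕ} (G : Graph n) (s : State) : Set where
  field
    solution : StrongTransitivePartition G (regs s 0)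
    written  : ∀ x → arrs s 2 (toℕ x) ≡ toℕ (StrongTransitivePartition.class solution x)
    optimal  : IsStrongTransitivity G (regs s 0)

-- The instance class C is a promise: the program need not recognise it.  The
-- summand 1 matters only for the graph without vertices.
MSTPLinearTimeOn : (∀ {n} → Graph n → Set) → Set
MSTPLinearTimeOn C =
  ∃[ p ] ∃[ c ] ∀ {n} (G : Graph n) → C G → (L : AdjacencyLists G) →
    ∃[ s ] ∃[ t ] ⟨ p , input L ⟩⇓⟨ s , t ⟩
                × t ≤ c * (1 + Graph.∣V∣ G + Graph.∣E∣ G)
                × OutputsMaximumSTP G s

{-# OPTIONS --safe #-}

-- In a split graph every set X of vertices of highest degree, all of degree at
-- least |X| − 1, is a clique.  Run through the vertices in order of
-- non-increasing degree and open a new class for the vertex at hand as long as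
-- its degree is at least the number m of classes opened so far; send every other
-- vertex to the first class.  The chosen vertices form a clique listed by
-- non-increasing degree, so this is a strong transitive partition of order m.
-- Conversely, a strong transitive partition of order k yields k vertices of
-- degree at least k − 1, whereas at most m vertices have degree at least m.
-- Bucketing the vertices by degree makes all of this linear.
module Submission where

open import Defs
open import Algebra.Properties.CommutativeSemigroup using (x∙yz≈y∙xz)
open import Data.Bool using (Bool; true; false; T; _∧_; if_then_else_)
open import Data.Bool.Properties using (T-∧; if-eta)
open import Data.Empty using (⊥)
open import Data.Fin using (Fin; zero; suc; toℕ; fromℕ<; _≟_)
import Data.Fin as Fin
open import Data.Fin.Properties using (toℕ-injective; toℕ<n; toℕ-fromℕ; toℕ-fromℕ<; any?)
open import Data.Fin.Subset using (Subset; _∈_; _∉_; _∪_; ⁅_⁆; ∁) renaming (⊥ to ∅)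
open import Data.Fin.Subset.Properties
  using (_∈?_; x∉p⇒x∈∁p; x∈∁p⇒x∉p; x∈p∪q⁻; x∈p∪q⁺; x∈⁅x⁆; x∈⁅y⁆⇒x≡y; ∉⊥)
open import Data.List
  using (List; []; _∷_; _++_; allFin; cartesianProduct; concat; drop; filterᵇ; head; length; map)
open import Data.List.Properties
  using (map-tabulate; map-++; map-∘; drop-map; length-drop; length-map; length-tabulate; take-all)
open import Data.List.Relation.Binary.Permutation.Propositional using (_↭_)
open import Data.List.Relation.Binary.Permutation.Propositional.Properties using (map⁺)
open import Data.Maybe using (fromMaybe)
open import Data.Nat hiding (_≟_)
import Data.Nat as ℕ
open import Data.Nat.ListAction using (sum)
open import Data.Nat.ListAction.Properties using (sum-++; sum-↭)
open import Data.Nat.Properties hiding (_≟_)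
open import Data.Nat.Solver using (module +-*-Solver)
open import Data.Product using (∃-syntax; _×_; _,_; proj₁; proj₂)
open import Data.Sum using (_⊎_; inj₁; inj₂; [_,_]′)
open import Data.Unit using (tt)
open import Function using (_∘_; id; Equivalence)
open import Level using (0ℓ)
open import Relation.Binary using (tri<; tri≈; tri>)
open import Relation.Binary.PropositionalEquality hiding ([_])
open import Relation.Nullary using (Dec; does; yes; no; ¬_; ¬?; contradiction)
open import Relation.Nullary.Decidable using (T?; _×-dec_; _⊎-dec_)
open import Relation.Unary using (Pred; Decidable; _⊆_)

private variable
  A B : Set
  n : ℕ

-- Counting by finite sums

∑ : List A → (A → ℕ) → ℕ
∑ xs f = sum (map f xs)

∑-mono : ∀ (xs : List A) {f g : A → ℕ} → (∀ x → f x ≤ g x) → ∑ xs f ≤ ∑ xs g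
∑-mono []       f≤g = z≤n
∑-mono (x ∷ xs) f≤g = +-mono-≤ (f≤g x) (∑-mono xs f≤g)

∑-cong : ∀ (xs : List A) {f g : A → ℕ} → (∀ x → f x ≡ g x) → ∑ xs f ≡ ∑ xs g
∑-cong []       f≡g = refl
∑-cong (x ∷ xs) f≡g = cong₂ _+_ (f≡g x) (∑-cong xs f≡g)

∑-zero : ∀ (xs : List A) → ∑ xs (λ _ → 0) ≡ 0
∑-zero []       = refl
∑-zero (_ ∷ xs) = ∑-zero xs

∑-length : ∀ (xs : List A) → ∑ xs (λ _ → 1) ≡ length xs
∑-length []       = refl
∑-length (_ ∷ xs) = cong suc (∑-length xs)

∑-+ : ∀ (xs : List A) (f g : A → ℕ) → ∑ xs (λ x → f x + g x) ≡ ∑ xs f + ∑ xs g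
∑-+ []       f g = refl
∑-+ (x ∷ xs) f g rewrite ∑-+ xs f g = begin
  f x + g x + (∑ xs f + ∑ xs g)   ≡⟨ +-assoc (f x) (g x) _ ⟩
  f x + (g x + (∑ xs f + ∑ xs g)) ≡⟨ cong (f x +_) (x∙yz≈y∙xz +-commutativeSemigroup (g x) (∑ xs f) _) ⟩
  f x + (∑ xs f + (g x + ∑ xs g)) ≡⟨ +-assoc (f x) (∑ xs f) _ ⟨
  f x + ∑ xs f + (g x + ∑ xs g)   ∎
  where open ≡-Reasoning

∑-swap : ∀ (xs : List A) (ys : List B) (f : A → B → ℕ) →
         ∑ xs (λ x → ∑ ys (f x)) ≡ ∑ ys (λ y → ∑ xs (λ x → f x y))
∑-swap []       ys f = sym (∑-zero ys)
∑-swap (x ∷ xs) ys f = trans (cong (∑ ys (f x) +_) (∑-swap xs ys f)) (sym (∑-+ ys (f x) _))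

∑-++ : ∀ (xs ys : List A) (f : A → ℕ) → ∑ (xs ++ ys) f ≡ ∑ xs f + ∑ ys f
∑-++ xs ys f = trans (cong sum (map-++ f xs ys)) (sum-++ (map f xs) (map f ys))

∑-map : ∀ (xs : List A) (g : A → B) (f : B → ℕ) → ∑ (map g xs) f ≡ ∑ xs (f ∘ g)
∑-map xs g f = cong sum (sym (map-∘ xs))

∑-concat : ∀ (xss : List (List A)) (f : A → ℕ) → ∑ (concat xss) f ≡ ∑ xss (λ xs → ∑ xs f)
∑-concat []         f = refl
∑-concat (xs ∷ xss) f = trans (∑-++ xs (concat xss) f) (cong (∑ xs f +_) (∑-concat xss f))

∑-cartesianProduct : ∀ (xs : List A) (ys : List B) (f : A × B → ℕ) →
                     ∑ (cartesianProduct xs ys) f ≡ ∑ xs (λ x → ∑ ys (λ y → f (x , y)))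
∑-cartesianProduct []       ys f = refl
∑-cartesianProduct (x ∷ xs) ys f =
  trans (∑-++ (map (x ,_) ys) _ f)
        (cong₂ _+_ (∑-map ys (x ,_) f) (∑-cartesianProduct xs ys f))

∑-filter : ∀ (p : A → Bool) (xs : List A) (f : A → ℕ) →
           ∑ (filterᵇ p xs) f ≡ ∑ xs (λ x → if p x then f x else 0)
∑-filter p []       f = refl
∑-filter p (x ∷ xs) f with p x
... | true  = cong (f x +_) (∑-filter p xs f)
... | false = ∑-filter p xs f

∑-↭ : ∀ {xs ys : List A} (f : A → ℕ) → xs ↭ ys → ∑ xs f ≡ ∑ ys f
∑-↭ f = sum-↭ ∘ map⁺ f

∑-allFin-suc : ∀ (f : Fin (suc n) → ℕ) → ∑ (allFin (suc n)) f ≡ f zero + ∑ (allFin n) (f ∘ suc)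
∑-allFin-suc {n} f = cong (λ xs → f zero + sum xs)
  (trans (map-tabulate suc f) (sym (map-tabulate id (f ∘ suc))))

-- Indicators and cardinalities of decidable sets of vertices

𝟙 : ∀ {ℓ} {P : Set ℓ} → Dec P → ℕ
𝟙 P? = if does P? then 1 else 0

𝟙-mono : ∀ {ℓ ℓ′} {P : Set ℓ} {Q : Set ℓ′} (P? : Dec P) (Q? : Dec Q) → (P → Q) → 𝟙 P? ≤ 𝟙 Q?
𝟙-mono (no _)  Q?      P⇒Q = z≤n
𝟙-mono (yes p) (yes _) P⇒Q = ≤-refl
𝟙-mono (yes p) (no ¬q) P⇒Q = contradiction (P⇒Q p) ¬q

# : ∀ {ℓ} {P : Pred (Fin n) ℓ} → Decidable P → ℕ
# {n} P? = ∑ (allFin n) (𝟙 ∘ P?)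

-- Sifts out the single term at y. With `p` constantly true this counts a singleton; with `p` a row
-- of the adjacency matrix it counts the occurrences of y in a neighbour list.
∑-select : ∀ (p : Fin n → Bool) (y : Fin n) →
           ∑ (allFin n) (λ x → if p x then 𝟙 (x ≟ y) else 0) ≡ (if p y then 1 else 0)
∑-select {suc n} p zero = begin
  _                                          ≡⟨ ∑-allFin-suc {n} _ ⟩
  b + ∑ (allFin n) (λ x → if p (suc x) then 0 else 0)
                                             ≡⟨ cong (b +_) (∑-cong (allFin n) (λ x → if-eta (p (suc x)))) ⟩
  b + ∑ (allFin n) (λ _ → 0)                 ≡⟨ cong (b +_) (∑-zero (allFin n)) ⟩
  b + 0                                      ≡⟨ +-identityʳ b ⟩
  b                                          ∎
  where
    open ≡-Reasoning
    b = if p zero then 1 else 0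
∑-select {suc n} p (suc y) = begin
  ∑ (allFin (suc n)) f                            ≡⟨ ∑-allFin-suc f ⟩
  f zero + ∑ (allFin n) (f ∘ suc)                 ≡⟨ cong (_+ ∑ (allFin n) (f ∘ suc)) (if-eta (p zero)) ⟩
  ∑ (allFin n) (f ∘ suc)                          ≡⟨ ∑-select (p ∘ suc) y ⟩
  (if p (suc y) then 1 else 0)                    ∎
  where
    open ≡-Reasoning
    f : Fin (suc n) → ℕ
    f x = if p x then 𝟙 (x ≟ suc y) else 0

#-singleton : ∀ (y : Fin n) → # (_≟ y) ≡ 1
#-singleton = ∑-select (λ _ → true)

module _ {ℓ ℓ′} {P : Pred (Fin n) ℓ} {Q : Pred (Fin n) ℓ′} (P? : Decidable P) (Q? : Decidable Q) where

  #-mono : P ⊆ Q → # P? ≤ # Q?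
  #-mono P⊆Q = ∑-mono (allFin n) (λ x → 𝟙-mono (P? x) (Q? x) P⊆Q)

  private
    #-suc : ∀ y → suc (# P?) ≡ ∑ (allFin n) (λ x → 𝟙 (x ≟ y) + 𝟙 (P? x))
    #-suc y = sym (trans (∑-+ (allFin n) (λ x → 𝟙 (x ≟ y)) (𝟙 ∘ P?)) (cong (_+ # P?) (#-singleton y)))

  -- The indicator of y can be added to that of `P` and still stays pointwise below that of `Q`,
  -- because y itself contributes nothing to `P`.
  #-strictMono : ∀ y → P ⊆ Q → Q y → ¬ P y → # P? < # Q?
  #-strictMono y P⊆Q Qy ¬Py = ≤-trans (≤-reflexive (#-suc y)) (∑-mono (allFin n) pointwise)
    where
      pointwise : ∀ x → 𝟙 (x ≟ y) + 𝟙 (P? x) ≤ 𝟙 (Q? x)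
      pointwise x with x ≟ y | P? x | Q? x
      ... | yes refl | yes Py | _      = contradiction Py ¬Py
      ... | yes refl | no _   | yes _  = ≤-refl
      ... | yes refl | no _   | no ¬Qy = contradiction Qy ¬Qy
      ... | no _     | yes Px | no ¬Qx = contradiction (P⊆Q Px) ¬Qx
      ... | no _     | yes _  | yes _  = ≤-refl
      ... | no _     | no _   | _      = z≤n

  #-insert : ∀ y → (∀ {x} → Q x → x ≡ y ⊎ P x) → # Q? ≤ suc (# P?)
  #-insert y Q⊆y∪P = ≤-trans (∑-mono (allFin n) pointwise) (≤-reflexive (sym (#-suc y)))
    where
      pointwise : ∀ x → 𝟙 (Q? x) ≤ 𝟙 (x ≟ y) + 𝟙 (P? x)
      pointwise x with x ≟ y | P? x | Q? x
      ... | _        | _      | no _  = z≤n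
      ... | yes _    | _      | yes _ = s≤s z≤n
      ... | no _     | yes _  | yes _ = ≤-refl
      ... | no x≢y   | no ¬Px | yes q = contradiction (Q⊆y∪P q) [ x≢y , ¬Px ]′

#≤n : ∀ {ℓ} {P : Pred (Fin n) ℓ} (P? : Decidable P) → # P? ≤ n
#≤n {n} P? = ≤-trans (∑-mono (allFin n) (λ x → 𝟙-mono (P? x) (yes tt) _))
                     (≤-reflexive (trans (∑-length (allFin n)) (length-tabulate id)))

#-colours : ∀ {ℓ} {P : Pred (Fin n) ℓ} (P? : Decidable P) (c : Fin n → ℕ) k →
            (∀ i → i < k → ∃[ x ] P x × c x ≡ i) → k ≤ # P?
#-colours P? c k hit = ≤-trans (below k ≤-refl) (#-mono (P<? k) P? proj₁)
  where
    P<? : ∀ j → Decidable (λ x → _ × c x < j)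
    P<? j x = P? x ×-dec (c x <? j)
    below : ∀ j → j ≤ k → j ≤ # (P<? j)
    below zero    _   = z≤n
    below (suc j) j<k with hit j j<k
    ... | x , Px , cx≡j = ≤-<-trans (below j (<⇒≤ j<k))
      (#-strictMono (P<? j) (P<? (suc j)) x (λ (p , lt) → p , m<n⇒m<1+n lt)
        (Px , s≤s (≤-reflexive cx≡j)) (λ (_ , lt) → <-irrefl cx≡j lt))

-- Reading an updated memory cell

[↦]-same : ∀ (f : ℕ → ℕ) i v → (f [ i ↦ v ]) i ≡ v
[↦]-same f i v with i ≡ᵇ i | ≡⇒≡ᵇ i i refl
... | true | _ = refl

[↦]-other : ∀ (f : ℕ → ℕ) {i} v {j} → j ≢ i → (f [ i ↦ v ]) j ≡ f j
[↦]-other f {i} v {j} j≢i with j ≡ᵇ i | ≡ᵇ⇒≡ j i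
... | true  | eq = contradiction (eq tt) j≢i
... | false | _  = refl

-- Degrees and greedy choices in split graphs

module GraphProperties (G : Graph n) where
  open Graph G hiding (sym)

  _~?_ : ∀ x y → Dec (x ~ y)
  x ~? y = T? (adj x y)

  ~-sym : ∀ {x y} → x ~ y → y ~ x
  ~-sym {x} {y} = subst T (Graph.sym G x y)

  ~-irrefl : ∀ {x} → ¬ (x ~ x)
  ~-irrefl {x} = subst T (irrefl x)

  -- `does (T? b)` computes to `b`, so the sum that `∑-filter` yields is already a sum of
  -- indicators.
  deg-# : ∀ x → deg x ≡ # (x ~?_)
  deg-# x = trans (sym (∑-length (neighbours x))) (∑-filter (adj x) (allFin n) (λ _ → 1))

  deg≤n : ∀ x → deg x ≤ n
  deg≤n x = ≤-trans (≤-reflexive (deg-# x)) (#≤n (x ~?_))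

  -- The handshake bound: one of the two orientations of an adjacent pair puts the smaller endpoint
  -- first, so `orient` charges the pair to an edge, and swapping the sums makes both totals ∣E∣.
  ∑-deg : ∑ (allFin n) deg ≤ ∣E∣ + ∣E∣
  ∑-deg = begin
    ∑ V deg
      ≡⟨ ∑-cong V deg-# ⟩
    ∑ V (λ x → ∑ V (λ y → 𝟙 (x ~? y)))
      ≤⟨ ∑-mono V (λ x → ∑-mono V (λ y → orient x y)) ⟩
    ∑ V (λ x → ∑ V (λ y → e x y + e y x))
      ≡⟨ ∑-cong V (λ x → ∑-+ V (e x) (λ y → e y x)) ⟩
    ∑ V (λ x → ∑ V (e x) + ∑ V (λ y → e y x))
      ≡⟨ ∑-+ V _ _ ⟩
    ∑ V (λ x → ∑ V (e x)) + ∑ V (λ x → ∑ V (λ y → e y x))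
      ≡⟨ cong (∑ V (λ x → ∑ V (e x)) +_) (∑-swap V V (λ x y → e y x)) ⟩
    ∑ V (λ x → ∑ V (e x)) + ∑ V (λ x → ∑ V (e x))
      ≡⟨ cong₂ _+_ count-edges count-edges ⟨
    ∣E∣ + ∣E∣ ∎
    where
      open ≤-Reasoning
      V = allFin n
      smaller-first : Fin n × Fin n → Bool
      smaller-first (x , y) = adj x y ∧ (toℕ x <ᵇ toℕ y)
      e : Fin n → Fin n → ℕ
      e x y = 𝟙 (T? (smaller-first (x , y)))
      count-edges : ∣E∣ ≡ ∑ V (λ x → ∑ V (e x))
      count-edges = trans (sym (∑-length edges))
        (trans (∑-filter smaller-first (cartesianProduct V V) _)
               (∑-cartesianProduct V V _))
      orient : ∀ x y → 𝟙 (x ~? y) ≤ e x y + e y x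
      orient x y with <-cmp (toℕ x) (toℕ y)
      ... | tri< x<y _ _ = ≤-trans
            (𝟙-mono (x ~? y) (T? _) (λ xy → Equivalence.from T-∧ (xy , <⇒<ᵇ x<y))) (m≤m+n _ _)
      ... | tri> _ _ y<x = ≤-trans
            (𝟙-mono (x ~? y) (T? _) (λ xy → Equivalence.from T-∧ (~-sym xy , <⇒<ᵇ y<x))) (m≤n+m _ _)
      ... | tri≈ _ x≡y _ rewrite toℕ-injective x≡y = ≤-trans
            (𝟙-mono (y ~? y) (T? (smaller-first (y , y))) (λ yy → contradiction yy ~-irrefl)) (m≤m+n (e y y) (e y y))

  -- The state of the greedy choice after the vertices in Seen have been offered
  -- in order of non-increasing degree: the m vertices of the set `chosen` have
  -- received the classes 0 , … , m − 1, in the order in which they were seen.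
  record Greedy (Seen : Pred (Fin n) 0ℓ) (m : ℕ) (cls : ℕ → ℕ) : Set where
    field
      chosen        : Subset n
      seen          : ∀ {u} → u ∈ chosen → Seen u
      size          : # (_∈? chosen) ≤ m
      class<m       : ∀ {u} → u ∈ chosen → cls (toℕ u) < m
      onto          : ∀ i → i < m → ∃[ u ] u ∈ chosen × cls (toℕ u) ≡ i
      antitone      : ∀ {u w} → u ∈ chosen → w ∈ chosen → cls (toℕ u) < cls (toℕ w) → deg w ≤ deg u
      chosen-deg    : ∀ {u} → u ∈ chosen → m ≤ suc (deg u)
      unchosen-deg  : ∀ {u} → Seen u → u ∉ chosen → deg u < m
      unchosen-zero : ∀ {u} → u ∉ chosen → cls (toℕ u) ≡ 0

  greedy-init : ∀ {Seen cls} → (∀ u → ¬ Seen u) → (∀ i → cls i ≡ 0) → Greedy Seen 0 cls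
  greedy-init unseen cls≡0 = record
    { chosen        = ∅
    ; seen          = λ u∈∅ → contradiction u∈∅ ∉⊥
    ; size          = ≤-trans (#-mono (_∈? ∅ {n}) none? ∉⊥) (≤-reflexive (∑-zero (allFin n)))
    ; class<m       = λ u∈∅ → contradiction u∈∅ ∉⊥
    ; onto          = λ _ ()
    ; antitone      = λ u∈∅ → contradiction u∈∅ ∉⊥
    ; chosen-deg    = λ _ → z≤n
    ; unchosen-deg  = λ {u} s _ → contradiction s (unseen u)
    ; unchosen-zero = λ _ → cls≡0 _
    }
    where
      none? : Decidable {A = Fin n} (λ _ → ⊥)
      none? _ = no id

  -- Covers two moves: passing over a vertex of degree below m, and going on to the next bucket,
  -- where no new vertex becomes seen.
  greedy-reject : ∀ {Seen Seen′ m cls} → Greedy Seen m cls →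
                  (∀ {u} → Seen u → Seen′ u) →
                  (∀ {u} → Seen′ u → deg u < m ⊎ Seen u) →
                  Greedy Seen′ m cls
  greedy-reject g Seen⇒Seen′ Seen′⇒ = record
    { Greedy g
    ; seen         = Seen⇒Seen′ ∘ seen
    ; unchosen-deg = λ s u∉ → [ id , (λ s → unchosen-deg s u∉) ]′ (Seen′⇒ s)
    }
    where open Greedy g

  -- Since x has the least degree so far, it may come last among the chosen, and m ≤ deg x carries
  -- over to all of them. Since x is new, writing its class overwrites none of theirs.
  greedy-accept : ∀ {Seen Seen′ m cls} x → Greedy Seen m cls →
                  (∀ {u} → Seen u → Seen′ u) →
                  (∀ {u} → Seen′ u → u ≡ x ⊎ Seen u) →
                  Seen′ x → ¬ Seen x →
                  (∀ {u} → Seen u → deg x ≤ deg u) →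
                  m ≤ deg x →
                  Greedy Seen′ (suc m) (cls [ toℕ x ↦ m ])
  greedy-accept {Seen} {Seen′} {m} {cls} x g Seen⇒Seen′ Seen′⇒ now before x-last m≤deg = record
    { chosen        = chosen′
    ; seen          = λ u∈ → [ (λ { refl → now }) , Seen⇒Seen′ ∘ seen ]′ (split u∈)
    ; size          = ≤-trans (#-insert (_∈? chosen) (_∈? chosen′) x split) (s≤s size)
    ; class<m       = class<m′
    ; onto          = onto′
    ; antitone      = antitone′
    ; chosen-deg    = λ u∈ → s≤s ([ (λ { refl → m≤deg }) , (λ u∈ → ≤-trans m≤deg (x-last (seen u∈))) ]′ (split u∈))
    ; unchosen-deg  = λ s u∉ → [ (λ { refl → contradiction x∈ u∉ })
                               , (λ s → m<n⇒m<1+n (unchosen-deg s (u∉ ∘ old))) ]′ (Seen′⇒ s)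
    ; unchosen-zero = λ {u} u∉ → trans (other (λ { refl → u∉ x∈ })) (unchosen-zero (u∉ ∘ old))
    }
    where
      open Greedy g
      cls′ = cls [ toℕ x ↦ m ]
      chosen′ = ⁅ x ⁆ ∪ chosen
      split : ∀ {u} → u ∈ chosen′ → u ≡ x ⊎ u ∈ chosen
      split u∈ = [ inj₁ ∘ x∈⁅y⁆⇒x≡y x , inj₂ ]′ (x∈p∪q⁻ ⁅ x ⁆ chosen u∈)
      old : ∀ {u} → u ∈ chosen → u ∈ chosen′
      old u∈ = x∈p∪q⁺ (inj₂ u∈)
      x∈ : x ∈ chosen′
      x∈ = x∈p∪q⁺ (inj₁ (x∈⁅x⁆ x))
      other : ∀ {u} → u ≢ x → cls′ (toℕ u) ≡ cls (toℕ u)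
      other u≢x = [↦]-other cls m (u≢x ∘ toℕ-injective)
      same : cls′ (toℕ x) ≡ m
      same = [↦]-same cls (toℕ x) m
      keep : ∀ {u} → u ∈ chosen → cls′ (toℕ u) ≡ cls (toℕ u)
      keep u∈ = other (λ { refl → before (seen u∈) })
      class<m′ : ∀ {u} → u ∈ chosen′ → cls′ (toℕ u) < suc m
      class<m′ u∈ with split u∈
      ... | inj₁ refl = s≤s (≤-reflexive same)
      ... | inj₂ u∈   = m<n⇒m<1+n (≤-<-trans (≤-reflexive (keep u∈)) (class<m u∈))
      onto′ : ∀ i → i < suc m → ∃[ u ] u ∈ chosen′ × cls′ (toℕ u) ≡ i
      onto′ i (s≤s i≤m) with m≤n⇒m<n∨m≡n i≤m
      ... | inj₂ refl = x , x∈ , same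
      ... | inj₁ i<m with onto i i<m
      ...   | u , u∈ , refl = u , old u∈ , keep u∈
      antitone′ : ∀ {u w} → u ∈ chosen′ → w ∈ chosen′ → cls′ (toℕ u) < cls′ (toℕ w) → deg w ≤ deg u
      antitone′ u∈ w∈ u<w with split u∈ | split w∈
      ... | inj₁ refl | inj₁ refl = ≤-refl
      ... | inj₁ refl | inj₂ w∈ₒ  = contradiction
            (subst₂ _<_ same (keep w∈ₒ) u<w) (<⇒≯ (class<m w∈ₒ))
      ... | inj₂ u∈ₒ  | inj₁ refl = x-last (seen u∈ₒ)
      ... | inj₂ u∈ₒ  | inj₂ w∈ₒ  = antitone u∈ₒ w∈ₒ (subst₂ _<_ (keep u∈ₒ) (keep w∈ₒ) u<w)

  -- A non-adjacent pair x ∈ S, y of X would leave x with too few neighbours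
  -- inside X, hence x has a neighbour c ∉ X.  Then c is adjacent to x and to all
  -- of K − c, and comparing deg c ≤ deg x , deg y with |K| excludes y from both K and S.
  module _ {S : Subset n} (indep : IsIndependent G S) (clique : IsClique G (∁ S))
           {X : Subset n}
           (dense    : ∀ {u} → u ∈ X → # (_∈? X) ≤ suc (deg u))
           (maximal  : ∀ {u w} → u ∈ X → w ∉ X → deg w ≤ deg u) where
    private
      K = ∁ S

      nbr∈K : ∀ {x u} → x ∈ S → x ~ u → u ∈ K
      nbr∈K {u = u} x∈S x~u with u ∈? S
      ... | yes u∈S = contradiction x~u (indep x∈S u∈S)
      ... | no  u∉S = x∉p⇒x∈∁p u∉S

      -- All neighbours of x lie in K, and y is a member of K outside the neighbourhood.
      K-misses : ∀ {x y} → x ∈ S → y ∈ K → ¬ (x ~ y) → deg x < # (_∈? K)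
      K-misses {x} {y} x∈S y∈K x≁y = ≤-<-trans (≤-reflexive (deg-# x))
        (#-strictMono (x ~?_) (_∈? K) y (nbr∈K x∈S) y∈K x≁y)

      deg≤K : ∀ {x} → x ∈ S → deg x ≤ # (_∈? K)
      deg≤K {x} x∈S = ≤-trans (≤-reflexive (deg-# x)) (#-mono (x ~?_) (_∈? K) (nbr∈K x∈S))

      N[_]? : ∀ c → Decidable (λ u → u ≡ c ⊎ c ~ u)
      N[ c ]? u = (u ≟ c) ⊎-dec (c ~? u)

      #N[_] : ∀ c → # (N[ c ]?) ≤ suc (deg c)
      #N[ c ] = ≤-trans (#-insert (c ~?_) (N[ c ]?) c id) (s≤s (≤-reflexive (sym (deg-# c))))

      K⊆N[_] : ∀ {c} → c ∈ K → ∀ {u} → u ∈ K → u ≡ c ⊎ c ~ u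
      K⊆N[_] {c} c∈K {u} u∈K with u ≟ c
      ... | yes u≡c = inj₁ u≡c
      ... | no  u≢c = inj₂ (clique c∈K u∈K (u≢c ∘ sym))

      S∌K : ∀ {u} → u ∈ S → u ∉ K
      S∌K u∈S u∈K = x∈∁p⇒x∉p u∈K u∈S

      -- K together with x lies in the closed neighbourhood of c, which has at most deg c + 1
      -- elements.
      K≤deg : ∀ {c x} → c ∈ K → x ∈ S → x ~ c → # (_∈? K) ≤ deg c
      K≤deg {c} {x} c∈K x∈S x~c = s≤s⁻¹ (≤-trans
        (#-strictMono (_∈? K) (N[ c ]?) x K⊆N[ c∈K ] (inj₂ (~-sym x~c)) (S∌K x∈S))
        #N[ c ])

      -- As for `K≤deg`, with the two distinct vertices x and y adjoined to K.
      K<deg : ∀ {c x y} → c ∈ K → x ∈ S → x ~ c → y ∈ S → y ~ c → x ≢ y → # (_∈? K) < deg c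
      K<deg {c} {x} {y} c∈K x∈S x~c y∈S y~c x≢y = s≤s⁻¹ (≤-trans (≤-<-trans
        (#-strictMono (_∈? K) K+x? x inj₂ (inj₁ refl) (S∌K x∈S))
        (#-strictMono K+x? (N[ c ]?) y
          [ (λ { refl → inj₂ (~-sym x~c) }) , K⊆N[ c∈K ] ]′ (inj₂ (~-sym y~c))
          [ x≢y ∘ sym , S∌K y∈S ]′))
        #N[ c ])
        where
          K+x? : Decidable (λ u → u ≡ x ⊎ u ∈ K)
          K+x? u = (u ≟ x) ⊎-dec (u ∈? K)

      no-gap : ∀ {x y} → x ∈ X → y ∈ X → x ∈ S → x ≢ y → ¬ ¬ (x ~ y)
      no-gap {x} {y} x∈X y∈X x∈S x≢y x≁y with any? (λ c → (x ~? c) ×-dec ¬? (c ∈? X))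
      -- X contains the deg x + 1 vertices of the closed neighbourhood of x and also y, against
      -- `dense`.
      ... | no  inside = <⇒≱ too-few (dense x∈X)
        where
          nbr∈X : ∀ {u} → x ~ u → u ∈ X
          nbr∈X {u} x~u with u ∈? X
          ... | yes u∈X = u∈X
          ... | no  u∉X = contradiction (u , x~u , u∉X) inside
          N[x]⊆X : ∀ {u} → u ≡ x ⊎ x ~ u → u ∈ X
          N[x]⊆X = [ (λ { refl → x∈X }) , nbr∈X ]′
          too-few : suc (deg x) < # (_∈? X)
          too-few = ≤-<-trans
            (≤-trans (s≤s (≤-reflexive (deg-# x)))
              (#-strictMono (x ~?_) (N[ x ]?) x inj₂ (inj₁ refl) ~-irrefl))
            (#-strictMono (N[ x ]?) (_∈? X) y N[x]⊆X y∈X [ x≢y ∘ sym , x≁y ]′)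
      ... | yes (c , x~c , c∉X) with y ∈? S
      -- Here y ∈ K, and deg x < |K| ≤ deg c ≤ deg x.
      ...   | no  y∉S = <⇒≱ (K-misses x∈S (x∉p⇒x∈∁p y∉S) x≁y)
                        (≤-trans (K≤deg (nbr∈K x∈S x~c) x∈S x~c) (maximal x∈X c∉X))
      ...   | yes y∈S with y ~? c
      -- |K| < deg c ≤ deg x ≤ |K|.
      ...     | yes y~c = <⇒≱ (K<deg (nbr∈K x∈S x~c) x∈S x~c y∈S y~c x≢y)
                          (≤-trans (maximal x∈X c∉X) (deg≤K x∈S))
      -- Now y misses c ∈ K, and deg y < |K| ≤ deg c ≤ deg y.
      ...     | no  y≁c = <⇒≱ (K-misses y∈S (nbr∈K x∈S x~c) y≁c)
                          (≤-trans (K≤deg (nbr∈K x∈S x~c) x∈S x~c) (maximal y∈X c∉X))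

    high-degree-clique : IsClique G X
    high-degree-clique {x} {y} x∈X y∈X x≢y with x ~? y | x ∈? S | y ∈? S
    ... | yes x~y | _ | _ = x~y
    ... | no x≁y | yes x∈S | _ = contradiction x≁y (no-gap x∈X y∈X x∈S x≢y)
    ... | no x≁y | no _ | yes y∈S = contradiction (x≁y ∘ ~-sym) (no-gap y∈X x∈X y∈S (x≢y ∘ sym))
    ... | no x≁y | no x∉S | no y∉S = contradiction (clique (x∉p⇒x∈∁p x∉S) (x∉p⇒x∈∁p y∉S) x≢y) x≁y

  -- The greedy partition and its optimality

  module GreedyOutcome (split : IsSplit G) {Seen m cls} (g : Greedy Seen m cls) (all-seen : ∀ u → Seen u) where
    open Greedy g

    cls<m : ∀ u → cls (toℕ u) < m
    cls<m u with u ∈? chosen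
    ... | yes u∈ = class<m u∈
    -- The default class 0 has been opened: the degree of an unchosen vertex is below m, so m is
    -- positive.
    ... | no  u∉ = ≤-<-trans (≤-reflexive (unchosen-zero u∉)) (≤-<-trans z≤n (unchosen-deg (all-seen u) u∉))

    positive⇒chosen : ∀ {u} → cls (toℕ u) ≢ 0 → u ∈ chosen
    positive⇒chosen {u} cls≢0 with u ∈? chosen
    ... | yes u∈ = u∈
    ... | no  u∉ = contradiction (unchosen-zero u∉) cls≢0

    -- Density is |chosen| ≤ m ≤ deg u + 1. Maximality is deg w < m ≤ deg u + 1 for w unchosen and u
    -- chosen.
    chosen-clique : IsClique G chosen
    chosen-clique = high-degree-clique (proj₁ (proj₂ split)) (proj₂ (proj₂ split))
      (λ u∈ → ≤-trans size (chosen-deg u∈))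
      (λ u∈ w∉ → s≤s⁻¹ (≤-trans (unchosen-deg (all-seen _) w∉) (chosen-deg u∈)))

    partition : StrongTransitivePartition G m
    partition = record
      { class     = λ u → fromℕ< (cls<m u)
      ; nonempty  = λ i → let u , _ , eq = onto (toℕ i) (toℕ<n i) in
                          u , toℕ-injective (trans (toℕ-fromℕ< (cls<m u)) eq)
      ; dominates = dominates
      }
      where
        dominates : ∀ {i j} → i Fin.< j →
                    StronglyDominates G (λ u → fromℕ< (cls<m u) ≡ i) (λ u → fromℕ< (cls<m u) ≡ j)
        dominates {i} {j} i<j y refl with onto (toℕ i) (toℕ<n i)
        ... | x , x∈ , clsx≡i =
          x , toℕ-injective (trans (toℕ-fromℕ< (cls<m x)) clsx≡i) ,
          chosen-clique x∈ y∈ (λ { refl → <-irrefl refl x<y }) , antitone x∈ y∈ x<y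
          where
            x<y : cls (toℕ x) < cls (toℕ y)
            x<y = subst₂ _<_ (sym clsx≡i) (toℕ-fromℕ< (cls<m y)) i<j
            -- Class j comes after another class, so it is not the default class 0 and holds chosen
            -- vertices only.
            y∈ : y ∈ chosen
            y∈ = positive⇒chosen (m<n⇒n≢0 x<y)

    -- A vertex of the last class has a neighbour of at least its own degree in
    -- each of the other k − 1 classes, so k vertices have degree at least k − 1.
    upper-bound : ∀ k → StrongTransitivePartition G k → k ≤ m
    upper-bound zero    _ = z≤n
    upper-bound (suc k) σ with suc k ≤? m
    ... | yes k<m = k<m
    ... | no  k≮m = ≤-trans many size
      where
        open StrongTransitivePartition σ
        last : Fin (suc k)
        last = Fin.fromℕ k
        y : Fin n
        y = proj₁ (nonempty last)
        y-last : class y ≡ last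
        y-last = proj₂ (nonempty last)
        colour : Fin n → ℕ
        colour = toℕ ∘ class
        below : ∀ i → i < k → ∃[ x ] (x ~ y × deg y ≤ deg x) × colour x ≡ i
        below i i<k with dominates {fromℕ< (m<n⇒m<1+n i<k)} {last}
                           (subst₂ _<_ (sym (toℕ-fromℕ< _)) (sym (toℕ-fromℕ k)) i<k) y y-last
        ... | x , x-i , x~y , dx≥dy = x , (x~y , dx≥dy) , trans (cong toℕ x-i) (toℕ-fromℕ< _)
        k≤deg : k ≤ deg y
        k≤deg = ≤-trans (#-colours (y ~?_) colour k λ i i<k →
                          let x , (x~y , _) , eq = below i i<k in x , ~-sym x~y , eq)
                        (≤-reflexive (sym (deg-# y)))
        high : ∀ i → i < suc k → ∃[ x ] deg y ≤ deg x × colour x ≡ i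
        high i (s≤s i≤k) with m≤n⇒m<n∨m≡n i≤k
        ... | inj₁ i<k  = let x , (_ , dx≥dy) , eq = below i i<k in x , dx≥dy , eq
        ... | inj₂ refl = y , ≤-refl , trans (cong toℕ y-last) (toℕ-fromℕ k)
        -- An unchosen u would satisfy deg u < m ≤ k ≤ deg y.
        high⊆chosen : ∀ {u} → deg y ≤ deg u → u ∈ chosen
        high⊆chosen {u} dy≤du with u ∈? chosen
        ... | yes u∈ = u∈
        ... | no  u∉ = contradiction (≤-trans k≤deg dy≤du)
                         (<⇒≱ (≤-trans (unchosen-deg (all-seen u) u∉) (s≤s⁻¹ (≰⇒> k≮m))))
        many : suc k ≤ # (_∈? chosen)
        many = ≤-trans (#-colours (λ u → deg y ≤? deg u) colour (suc k) high)
                       (#-mono (λ u → deg y ≤? deg u) (_∈? chosen) high⊆chosen)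

-- Running times of programs

drop-< : ∀ j (xs : List A) → j < length xs →
         ∃[ x ] ∃[ ys ] drop j xs ≡ x ∷ ys × drop (suc j) xs ≡ ys
drop-< zero    (x ∷ xs) _         = x , xs , refl , refl
drop-< (suc j) (x ∷ xs) (s≤s j<l) = drop-< j xs j<l

-- An upper bound in place of the exact step count lets branches of unequal cost and loops be
-- composed.
Terminates : Program → State → ℕ → (State → Set) → Set
Terminates p s b Q = ∃[ s′ ] ∃[ t ] ⟨ p , s ⟩⇓⟨ s′ , t ⟩ × t ≤ b × Q s′

seq : ∀ {p q s b c Q R} → Terminates p s b Q → (∀ {s′} → Q s′ → Terminates q s′ c R) →
      Terminates (p ⨾ q) s (b + c) R
seq (_ , _ , p⇓ , t≤b , Qs′) then-q with then-q Qs′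
... | _ , _ , q⇓ , u≤c , Rs″ = _ , _ , ⇓seq p⇓ q⇓ , +-mono-≤ t≤b u≤c , Rs″

Holds? : ∀ b s → Dec (Holds b s)
Holds? (e₁ ≺ e₂) s = eval e₁ s <? eval e₂ s

¬Holds⇒Fails : ∀ b {s} → ¬ Holds b s → Fails b s
¬Holds⇒Fails (e₁ ≺ e₂) = id

-- The first argument of the invariant I bounds the number of remaining rounds.
while : ∀ {b p c} (I : ℕ → State → Set) →
        (∀ {s} → I 0 s → ¬ Holds b s) →
        (∀ {k s} → I (suc k) s → Holds b s → Terminates p s c (I k)) →
        ∀ k {s} → I k s →
        Terminates (WHILE b DO p OD) s (costᵗ b + k * (costᵗ b + c))
                   (λ s′ → (∃[ j ] I j s′) × ¬ Holds b s′)
while {b} I stop step k {s} Iks with Holds? b s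
... | no ¬h = s , _ , ⇓done (¬Holds⇒Fails b ¬h) , m≤m+n (costᵗ b) _ , (k , Iks) , ¬h
while I stop step zero Iks | yes h = contradiction h (stop Iks)
while {b} {c = c} I stop step (suc k) Iks | yes h with step Iks h
... | s₁ , t , p⇓ , t≤c , Ik with while I stop step k Ik
...   | s₂ , u , w⇓ , u≤ , done =
  s₂ , _ , ⇓while h p⇓ w⇓ , +-monoʳ-≤ (costᵗ b) bound , done
  where
    open ≤-Reasoning
    bound : t + u ≤ costᵗ b + c + k * (costᵗ b + c)
    bound = begin
      t + u                                       ≤⟨ +-mono-≤ t≤c u≤ ⟩
      c + (costᵗ b + k * (costᵗ b + c))           ≡⟨ +-assoc c (costᵗ b) _ ⟨
      c + costᵗ b + k * (costᵗ b + c)             ≡⟨ cong (_+ k * (costᵗ b + c)) (+-comm c (costᵗ b)) ⟩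
      costᵗ b + c + k * (costᵗ b + c)             ∎

-- The program

countDegree countDegrees link linkAll select selectAll strongTransitivity : Program

-- Array 3 receives the degrees.
countDegree  = 3 ⟦ 1 ⟦ reg 1 ⟧ ⟧≔ inc (3 ⟦ 1 ⟦ reg 1 ⟧ ⟧)
             ⨾ 1 ≔ inc (reg 1)
countDegrees = WHILE reg 1 ≺ 0 ⟦ reg 0 ⟧ DO countDegree OD

-- Vertices of equal degree δ form a linked list in decreasing order, starting at
-- array 4 [ δ + 1 ] and continued by array 5; in links, vertex x is stored as
-- x + 1 and 0 ends the list.
link    = 5 ⟦ reg 2 ⟧≔ 4 ⟦ inc (3 ⟦ reg 2 ⟧) ⟧
        ⨾ 4 ⟦ inc (3 ⟦ reg 2 ⟧) ⟧≔ inc (reg 2)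
        ⨾ 2 ≔ inc (reg 2)
linkAll = WHILE reg 2 ≺ reg 0 DO link OD

-- Register 3 is one more than the degree under consideration, register 4 the
-- link being followed and register 5 the number of classes opened so far.
select    = IF lit 0 ≺ reg 4
            THEN IF reg 5 ≺ reg 3
                 THEN 2 ⟦ dec (reg 4) ⟧≔ reg 5 ⨾ 5 ≔ inc (reg 5)
                 ELSE skip FI
               ⨾ 4 ≔ 5 ⟦ dec (reg 4) ⟧
            ELSE 3 ≔ dec (reg 3) ⨾ 4 ≔ 4 ⟦ reg 3 ⟧ FI
selectAll = WHILE lit 0 ≺ reg 3 DO select OD

strongTransitivity =
  countDegrees ⨾ linkAll ⨾ 3 ≔ inc (inc (reg 0)) ⨾ selectAll ⨾ 0 ≔ reg 5

-- Correctness and running time of the program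

module Correctness (G : Graph n) (L : AdjacencyLists G) where
  open Graph G hiding (sym)
  open GraphProperties G
  open AdjacencyLists L hiding (input)

  entries : List (Fin n)
  entries = concat (map adjList (allFin n))

  -- By symmetry of adjacency, y occurs exactly once in the list of each of its neighbours and in no
  -- other list. Degrees can therefore be counted in one pass over array 1 that ignores where the
  -- lists begin.
  entries-count : ∀ y → ∑ entries (λ x → 𝟙 (x ≟ y)) ≡ deg y
  entries-count y = begin
    ∑ entries (λ x → 𝟙 (x ≟ y))
      ≡⟨ ∑-concat (map adjList (allFin n)) _ ⟩
    ∑ (map adjList (allFin n)) (λ xs → ∑ xs (λ x → 𝟙 (x ≟ y)))
      ≡⟨ ∑-map (allFin n) adjList _ ⟩
    ∑ (allFin n) (λ z → ∑ (adjList z) (λ x → 𝟙 (x ≟ y)))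
      ≡⟨ ∑-cong (allFin n) (λ z → trans (∑-↭ _ (correct z))
           (trans (∑-filter (adj z) (allFin n) _) (∑-select (adj z) y))) ⟩
    ∑ (allFin n) (λ z → 𝟙 (z ~? y))
      ≡⟨ ∑-cong (allFin n) (λ z → cong (λ b → if b then 1 else 0) (Graph.sym G z y)) ⟩
    # (y ~?_)
      ≡⟨ deg-# y ⟨
    deg y ∎
    where open ≡-Reasoning

  entries-length : length entries ≤ ∣E∣ + ∣E∣
  entries-length = begin
    length entries
      ≡⟨ ∑-length entries ⟨
    ∑ entries (λ _ → 1)
      ≡⟨ ∑-concat (map adjList (allFin n)) _ ⟩
    ∑ (map adjList (allFin n)) (λ xs → ∑ xs (λ _ → 1))
      ≡⟨ ∑-map (allFin n) adjList _ ⟩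
    ∑ (allFin n) (λ z → ∑ (adjList z) (λ _ → 1))
      ≡⟨ ∑-cong (allFin n) (λ z → trans (∑-↭ _ (correct z)) (∑-length (neighbours z))) ⟩
    ∑ (allFin n) deg
      ≤⟨ ∑-deg ⟩
    ∣E∣ + ∣E∣ ∎
    where open ≤-Reasoning

  offset-end : offset n ≡ length entries
  offset-end = cong (length ∘ concat) (take-all n (map adjList (allFin n))
    (≤-reflexive (trans (length-map adjList (allFin n)) (length-tabulate id))))

  entry-drop : ∀ j {x xs} → drop j entries ≡ x ∷ xs → entry j ≡ toℕ x
  entry-drop j eq = cong (fromMaybe 0 ∘ head) (trans (drop-map j entries) (cong (map toℕ) eq))

  -- The shift by one leaves bucket 0 empty, so that key 0 can end the selection loop, and it turns
  -- the acceptance rule m ≤ deg x into the test m < key x.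
  key : Fin n → ℕ
  key x = suc (deg x)

  -- First phase: counting degrees

  record Initial (s : State) : Set where
    field
      order   : regs s 0 ≡ n
      reg2    : regs s 2 ≡ 0
      reg4    : regs s 4 ≡ 0
      reg5    : regs s 5 ≡ 0
      array2  : ∀ i → arrs s 2 i ≡ 0
      array4  : ∀ i → arrs s 4 i ≡ 0

  -- Occurrences counted and occurrences still unread always add up to the degree; reading a cell
  -- moves one of them across. `pos` makes k the number of unread cells.
  record Counting (k : ℕ) (s : State) : Set where
    field
      initial : Initial s
      end     : arrs s 0 n ≡ length entries
      cells   : ∀ j → arrs s 1 j ≡ entry j
      pos     : regs s 1 + k ≡ length entries
      count   : ∀ y → arrs s 3 (toℕ y) + ∑ (drop (regs s 1) entries) (λ x → 𝟙 (x ≟ y)) ≡ deg y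

  Degrees : State → Set
  Degrees s = Initial s × (∀ y → arrs s 3 (toℕ y) ≡ deg y)

  counting-init : Counting (length entries) (input L)
  counting-init = record
    { initial = record { order = refl ; reg2 = refl ; reg4 = refl ; reg5 = refl
                       ; array2 = λ _ → refl ; array4 = λ _ → refl }
    ; end     = offset-end
    ; cells   = λ _ → refl
    ; pos     = refl
    -- Array 3 starts at zero, so every occurrence is still unread.
    ; count   = entries-count
    }

  counting-more : ∀ {k s} → Counting k s → Holds (reg 1 ≺ 0 ⟦ reg 0 ⟧) s →
                  regs s 1 < length entries
  counting-more {s = s} inv h = ≤-trans h (≤-reflexive (trans (cong (arrs s 0) order) end))
    where
      open Counting inv
      open Initial initial

  counting-step : ∀ {k s} → Counting (suc k) s → Holds (reg 1 ≺ 0 ⟦ reg 0 ⟧) s →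
                  Terminates countDegree s 10 (Counting k)
  counting-step {k} {s} inv h with drop-< (regs s 1) entries (counting-more inv h)
  ... | x , xs , dropped , dropped′ = _ , _ , ⇓seq ⇓arr ⇓reg , ≤-refl , next
    where
      open Counting inv
      open Initial initial
      j = regs s 1
      cell : arrs s 1 j ≡ toℕ x
      cell = trans (cells j) (entry-drop j dropped)
      count′ : ∀ y → (arrs s 3 [ arrs s 1 j ↦ suc (arrs s 3 (arrs s 1 j)) ]) (toℕ y)
                   + ∑ (drop (suc j) entries) (λ x → 𝟙 (x ≟ y)) ≡ deg y
      count′ y with count y
      ... | before rewrite cell | dropped | dropped′ with x ≟ y
      ...   | yes refl = trans (cong (_+ ∑ xs _) ([↦]-same (arrs s 3) (toℕ x) _)) (trans (sym (+-suc _ _)) before)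
      ...   | no  x≢y  = trans (cong (_+ ∑ xs _) ([↦]-other (arrs s 3) _ (x≢y ∘ sym ∘ toℕ-injective))) before
      next : Counting k _
      next = record
        { initial = record { Initial initial }
        ; end = end ; cells = cells
        ; pos = trans (sym (+-suc j k)) pos
        ; count = count′
        }

  countDegrees-correct : Terminates countDegrees (input L) (4 + length entries * 14) Degrees
  countDegrees-correct with while Counting stop counting-step (length entries) counting-init
    where
      stop : ∀ {s} → Counting 0 s → ¬ Holds (reg 1 ≺ 0 ⟦ reg 0 ⟧) s
      stop inv h = <-irrefl (trans (sym (+-identityʳ _)) (Counting.pos inv)) (counting-more inv h)
  ... | s , t , run , t≤ , (k , inv) , done = s , t , run , t≤ , initial , degrees
    where
      open Counting inv
      open Initial initial
      -- The loop rule leaves k unknown; that nothing is unread follows from the failed test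
      -- instead.
      exhausted : drop (regs s 1) entries ≡ []
      exhausted with drop (regs s 1) entries | length-drop (regs s 1) entries
      ... | []     | _  = refl
      ... | _ ∷ _  | eq = contradiction
              (subst (regs s 1 <_) (sym (trans (cong (arrs s 0) order) end)) (m>n⇒n<m eq)) done
        where
          m>n⇒n<m : ∀ {m i l} → suc l ≡ m ∸ i → i < m
          m>n⇒n<m {m} {i} eq = m∸n≢0⇒n<m (λ z → 1+n≢0 (trans eq z))
      degrees : ∀ y → arrs s 3 (toℕ y) ≡ deg y
      degrees y = trans (sym (trans (cong (λ l → _ + ∑ l _) exhausted) (+-identityʳ _))) (count y)

  -- Second phase: linking the vertices of equal degree

  -- The link v leads to the largest vertex below i whose key is d.
  record Latest (d i v : ℕ) : Set where
    field
      target  : ∀ {w} → v ≡ suc w → ∃[ x ] toℕ x ≡ w × w < i × key x ≡ d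
      largest : ∀ {u} → v ≤ toℕ u → toℕ u < i → key u ≢ d

  latest-≤ : ∀ {d i v} → Latest d i v → v ≤ i
  latest-≤ {v = zero}  l = z≤n
  latest-≤ {v = suc _} l = let _ , _ , w<i , _ = Latest.target l refl in w<i

  -- `heads` moves along with the current vertex, while `links x` is frozen at x: it is the head
  -- that the bucket of x had just before x was inserted.
  record Linking (k : ℕ) (s : State) : Set where
    field
      order   : regs s 0 ≡ n
      reg4    : regs s 4 ≡ 0
      reg5    : regs s 5 ≡ 0
      array2  : ∀ i → arrs s 2 i ≡ 0
      degrees : ∀ y → arrs s 3 (toℕ y) ≡ deg y
      pos     : regs s 2 + k ≡ n
      heads   : ∀ d → Latest d (regs s 2) (arrs s 4 d)
      links   : ∀ x → toℕ x < regs s 2 → Latest (key x) (toℕ x) (arrs s 5 (toℕ x))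

  linking-init : ∀ {s} → Degrees s → Linking n s
  linking-init {s} (initial , degrees) = record
    { Initial initial ; degrees = degrees
    ; pos   = cong (_+ n) reg2
    ; heads = λ d → record
        { target  = λ eq → contradiction (trans (sym eq) (array4 d)) 1+n≢0
        ; largest = λ {u} _ u< → contradiction (subst (toℕ u <_) reg2 u<) n≮0 }
    ; links = λ x x< → contradiction (subst (toℕ x <_) reg2 x<) n≮0
    }
    where open Initial initial

  linking-step : ∀ {k s} → Linking (suc k) s → Holds (reg 2 ≺ reg 0) s →
                 Terminates link s 15 (Linking k)
  linking-step {k} {s} inv h = _ , _ , ⇓seq ⇓arr (⇓seq ⇓arr ⇓reg) , ≤-refl , next
    where
      open Linking inv
      i = regs s 2
      i<n : i < n
      i<n = subst (i <_) order h
      x : Fin n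
      x = fromℕ< i<n
      x≡i : toℕ x ≡ i
      x≡i = toℕ-fromℕ< i<n
      keyx : suc (arrs s 3 i) ≡ key x
      keyx = cong suc (trans (cong (arrs s 3) (sym x≡i)) (degrees x))
      heads′ : ∀ d → Latest d (suc i) ((arrs s 4 [ suc (arrs s 3 i) ↦ suc i ]) d)
      heads′ d with key x ℕ.≟ d
      ... | yes refl = subst (Latest (key x) (suc i)) (sym newest) (record
              { target  = λ { refl → x , x≡i , ≤-refl , refl }
              ; largest = λ v≤u u<v → contradiction v≤u (<⇒≱ u<v) })
        where
          newest : (arrs s 4 [ suc (arrs s 3 i) ↦ suc i ]) (key x) ≡ suc i
          newest = trans (cong (arrs s 4 [ suc (arrs s 3 i) ↦ suc i ]) (sym keyx))
                         ([↦]-same (arrs s 4) (suc (arrs s 3 i)) (suc i))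
      ... | no key≢d = subst (Latest d (suc i)) (sym unchanged) (record
              { target  = λ eq → let y , y≡w , w<i , keyy = target eq in y , y≡w , m<n⇒m<1+n w<i , keyy
              ; largest = larger })
        where
          open Latest (heads d)
          unchanged : (arrs s 4 [ suc (arrs s 3 i) ↦ suc i ]) d ≡ arrs s 4 d
          unchanged = [↦]-other (arrs s 4) (suc i) (λ d≡ → key≢d (sym (trans d≡ keyx)))
          larger : ∀ {u} → arrs s 4 d ≤ toℕ u → toℕ u < suc i → key u ≢ d
          larger {u} v≤u (s≤s u≤i) with m≤n⇒m<n∨m≡n u≤i
          ... | inj₁ u<i = largest v≤u u<i
          ... | inj₂ u≡i = λ keyu → key≢d (trans (cong key (toℕ-injective (trans x≡i (sym u≡i)))) keyu)
      links′ : ∀ y → toℕ y < suc i →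
               Latest (key y) (toℕ y) ((arrs s 5 [ i ↦ arrs s 4 (suc (arrs s 3 i)) ]) (toℕ y))
      links′ y (s≤s y≤i) with m≤n⇒m<n∨m≡n y≤i
      ... | inj₁ y<i = subst (Latest (key y) (toℕ y))
              (sym ([↦]-other (arrs s 5) _ (<⇒≢ y<i))) (links y y<i)
      ... | inj₂ y≡i = subst (Latest (key y) (toℕ y)) (sym new) (subst₂ (λ d j → Latest d j (arrs s 4 d))
              (cong key x≡y) (sym y≡i) (heads (key x)))
        where
          x≡y : x ≡ y
          x≡y = toℕ-injective (trans x≡i (sym y≡i))
          new : (arrs s 5 [ i ↦ arrs s 4 (suc (arrs s 3 i)) ]) (toℕ y) ≡ arrs s 4 (key y)
          new = trans (cong (arrs s 5 [ i ↦ _ ]) y≡i)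
                 (trans ([↦]-same (arrs s 5) i _)
                        (cong (arrs s 4) (trans keyx (cong key x≡y))))
      next : Linking k _
      next = record
        { order = order ; reg4 = reg4 ; reg5 = reg5 ; array2 = array2 ; degrees = degrees
        ; pos = trans (sym (+-suc i k)) pos
        ; heads = heads′
        ; links = links′
        }

  Linked : State → Set
  Linked s = Linking 0 s

  linkAll-correct : ∀ {s} → Degrees s → Terminates linkAll s (3 + n * 18) Linked
  linkAll-correct degs with while Linking stop linking-step n (linking-init degs)
    where
      stop : ∀ {s} → Linking 0 s → ¬ Holds (reg 2 ≺ reg 0) s
      stop inv h = <-irrefl (trans (trans (sym (+-identityʳ _)) pos) (sym order)) h
        where open Linking inv
  ... | s , t , run , t≤ , (k , inv) , done = s , t , run , t≤ , subst (λ k → Linking k s) k≡0 inv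
    where
      open Linking inv
      -- The failed test gives n ≤ `regs s 2`, and `pos` gives the converse, so no vertex remains to
      -- be linked.
      k≡0 : k ≡ 0
      k≡0 = +-cancelˡ-≡ (regs s 2) k 0 (trans pos (trans n≡i (sym (+-identityʳ _))))
        where
          n≡i : n ≡ regs s 2
          n≡i = ≤-antisym (subst (_≤ regs s 2) order (≮⇒≥ done)) (subst (regs s 2 ≤_) pos (m≤m+n _ k))

  -- Third phase: greedy selection by non-increasing degree

  -- The vertices met before link v of the list for key d, in decreasing
  -- lexicographic order of (key, vertex).
  Visited : ℕ → ℕ → Pred (Fin n) 0ℓ
  Visited d v u = d < key u ⊎ (key u ≡ d × v ≤ toℕ u)

  unvisited? : ∀ d v → Decidable (λ u → ¬ Visited d v u)
  unvisited? d v u = ¬? ((d <? key u) ⊎-dec ((key u ℕ.≟ d) ×-dec (v ≤? toℕ u)))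

  -- `fuel` bounds a potential: each round either lowers the key or visits one more vertex, so the
  -- key plus the number of unvisited vertices drops.
  record Selecting (k : ℕ) (s : State) : Set where
    field
      heads  : ∀ d → Latest d n (arrs s 4 d)
      links  : ∀ x → Latest (key x) (toℕ x) (arrs s 5 (toℕ x))
      link-d : ∀ {w} → regs s 4 ≡ suc w → ∃[ x ] toℕ x ≡ w × key x ≡ regs s 3
      fuel   : regs s 3 + # (unvisited? (regs s 3) (regs s 4)) ≤ k
      greedy : Greedy (Visited (regs s 3) (regs s 4)) (regs s 5) (arrs s 2)

  -- At link 0 the whole bucket of the current key counts as visited, so the starting key must
  -- exceed every key. Keys are at most n + 1, hence the start at n + 2.
  selecting-init : ∀ {s} → Linked s → Terminates (3 ≔ inc (inc (reg 0))) s 4 (Selecting (2 + n + n))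
  selecting-init {s} inv = _ , _ , ⇓reg , ≤-refl , record
    { heads  = λ d → subst (λ i → Latest d i (arrs s 4 d)) all (heads d)
    ; links  = λ x → links x (subst (toℕ x <_) (sym all) (toℕ<n x))
    ; link-d = λ eq → contradiction (trans (sym eq) reg4) 1+n≢0
    ; fuel   = +-mono-≤ (≤-reflexive (cong (2 +_) order)) (#≤n (unvisited? (2 + regs s 0) (regs s 4)))
    ; greedy = subst (λ m → Greedy (Visited (2 + regs s 0) (regs s 4)) m (arrs s 2)) (sym reg5)
                 (greedy-init nothing array2)
    }
    where
      open Linking inv
      all : regs s 2 ≡ n
      all = trans (sym (+-identityʳ _)) pos
      nothing : ∀ u → ¬ Visited (2 + regs s 0) (regs s 4) u
      nothing u vis = <⇒≱ (s≤s (s≤s (deg≤n u))) (subst (λ n → 2 + n ≤ key u) order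
        ([ <⇒≤ , ≤-reflexive ∘ sym ∘ proj₁ ]′ vis))

  module _ {d v v′ : ℕ} {x : Fin n} (v≡ : v ≡ suc (toℕ x)) (keyx : key x ≡ d)
           (latest : Latest (key x) (toℕ x) v′) where
    open Latest latest

    visited-before : ¬ Visited d v x
    visited-before (inj₁ d<)      = <-irrefl (sym keyx) d<
    visited-before (inj₂ (_ , v≤)) = <⇒≱ ≤-refl (subst (_≤ toℕ x) v≡ v≤)

    v′≤x : v′ ≤ toℕ x
    v′≤x = latest-≤ latest

    visited-now : Visited d v′ x
    visited-now = inj₂ (keyx , v′≤x)

    visited-grows : ∀ {u} → Visited d v u → Visited d v′ u
    visited-grows (inj₁ d<)          = inj₁ d<
    visited-grows (inj₂ (keyu , v≤)) = inj₂ (keyu , ≤-trans v′≤x (<⇒≤ (subst (_≤ _) v≡ v≤)))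

    -- By `largest`, no vertex u of this key satisfies v′ ≤ u < x, so following the link adds x
    -- alone.
    visited-one : ∀ {u} → Visited d v′ u → u ≡ x ⊎ Visited d v u
    visited-one (inj₁ d<) = inj₂ (inj₁ d<)
    visited-one {u} (inj₂ (keyu , v′≤u)) with <-cmp (toℕ u) (toℕ x)
    ... | tri< u<x _ _ = contradiction (trans keyu (sym keyx)) (largest v′≤u u<x)
    ... | tri≈ _ u≡x _ = inj₁ (toℕ-injective u≡x)
    ... | tri> _ _ x<u = inj₂ (inj₂ (keyu , subst (_≤ toℕ u) (sym v≡) x<u))

    unvisited-shrinks : # (unvisited? d v′) < # (unvisited? d v)
    unvisited-shrinks = #-strictMono (unvisited? d v′) (unvisited? d v) x
      (_∘ visited-grows) visited-before (λ ¬vis → ¬vis visited-now)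

  visited-deg : ∀ {d v u x} → key x ≡ d → Visited d v u → deg x ≤ deg u
  visited-deg refl (inj₁ d<)         = <⇒≤ (s≤s⁻¹ d<)
  visited-deg refl (inj₂ (keyu , _)) = ≤-reflexive (sym (suc-injective keyu))

  -- An empty link leads to the next lower key; otherwise the vertex behind the link is accepted or
  -- rejected. The bound 17 is the cost of accepting, the dearest of the three branches.
  selecting-step : ∀ {k s} → Selecting (suc k) s → Holds (lit 0 ≺ reg 3) s →
                   Terminates select s 17 (Selecting k)
  selecting-step {k} {s} inv 0<d with 0 <? regs s 4
  ... | no v≯0 = _ , _ , ⇓else v≯0 (⇓seq ⇓reg ⇓reg) , ≤ᵇ⇒≤ _ _ tt , record
    { heads  = heads
    ; links  = links
    ; link-d = λ eq → let x , x≡w , _ , keyx = target eq in x , x≡w , keyx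
    ; fuel   = s≤s⁻¹ (≤-trans (+-mono-≤ (≤-reflexive d≡)
                 (#-mono (unvisited? d′ v′) (unvisited? (regs s 3) (regs s 4)) (_∘ down)))
                 fuel)
    ; greedy = greedy-reject greedy down (inj₂ ∘ up)
    }
    where
      open Selecting inv
      d′ = pred (regs s 3)
      v′ = arrs s 4 d′
      open Latest (heads d′)
      d≡ : suc d′ ≡ regs s 3
      d≡ = suc-pred (regs s 3) {{>-nonZero 0<d}}
      v≡0 : regs s 4 ≡ 0
      v≡0 = n≤0⇒n≡0 (≮⇒≥ v≯0)
      down : ∀ {u} → Visited (regs s 3) (regs s 4) u → Visited d′ v′ u
      down (inj₁ d<)       = inj₁ (<-trans (≤-reflexive d≡) d<)
      down (inj₂ (keyu , _)) = inj₁ (≤-reflexive (trans d≡ (sym keyu)))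
      up : ∀ {u} → Visited d′ v′ u → Visited (regs s 3) (regs s 4) u
      up {u} (inj₁ d′<) with m≤n⇒m<n∨m≡n (subst (_≤ key u) d≡ d′<)
      ... | inj₁ d<   = inj₁ d<
      -- The old list has ended at link 0, so its entire bucket is visited already.
      ... | inj₂ d≡u  = inj₂ (sym d≡u , subst (_≤ toℕ u) (sym v≡0) z≤n)
      -- The new link is the head of its bucket, so no vertex of that key lies at or above it.
      up {u} (inj₂ (keyu , v′≤)) = contradiction keyu (largest v′≤ (toℕ<n u))
  ... | yes 0<v with Selecting.link-d inv (sym (suc-pred (regs s 4) {{>-nonZero 0<v}}))
  ...   | x , x≡ , keyx = offer (regs s 5 <? regs s 3)
    where
      open Selecting inv
      m = regs s 5
      d = regs s 3
      v′ = arrs s 5 (pred (regs s 4))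
      v≡ : regs s 4 ≡ suc (toℕ x)
      v≡ = trans (sym (suc-pred (regs s 4) {{>-nonZero 0<v}})) (cong suc (sym x≡))
      latest : Latest (key x) (toℕ x) v′
      latest = subst (λ i → Latest (key x) (toℕ x) (arrs s 5 i)) x≡ (links x)
      link-d′ : ∀ {w} → v′ ≡ suc w → ∃[ y ] toℕ y ≡ w × key y ≡ d
      link-d′ eq = let y , y≡w , _ , keyy = Latest.target latest eq in y , y≡w , trans keyy keyx
      fuel′ : d + # (unvisited? d v′) ≤ k
      fuel′ = s≤s⁻¹ (≤-trans (+-monoʳ-< d (unvisited-shrinks v≡ keyx latest)) fuel)
      offer : Dec (m < d) → Terminates select s 17 (Selecting k)
      offer (yes m<d) =
        _ , _ , ⇓then 0<v (⇓seq (⇓then m<d (⇓seq ⇓arr ⇓reg)) ⇓reg) , ≤ᵇ⇒≤ _ _ tt , record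
        { heads = heads ; links = links ; link-d = link-d′ ; fuel = fuel′
        ; greedy = subst (λ i → Greedy (Visited d v′) (suc m) (arrs s 2 [ i ↦ m ])) x≡
            (greedy-accept x greedy
              (visited-grows v≡ keyx latest) (visited-one v≡ keyx latest)
              (visited-now v≡ keyx latest) (visited-before v≡ keyx latest)
              (visited-deg keyx) (s≤s⁻¹ (subst (m <_) (sym keyx) m<d)))
        }
      offer (no m≮d) =
        _ , _ , ⇓then 0<v (⇓seq (⇓else m≮d ⇓skip) ⇓reg) , ≤ᵇ⇒≤ _ _ tt , record
        { heads = heads ; links = links ; link-d = link-d′ ; fuel = fuel′
        ; greedy = greedy-reject greedy (visited-grows v≡ keyx latest)
            -- The failed test says key x ≤ m, which is deg x < m.
            ([ (λ { refl → inj₁ (subst (_≤ m) (sym keyx) (≮⇒≥ m≮d)) }) , inj₂ ]′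
              ∘ visited-one v≡ keyx latest)
        }

  Selected : State → Set
  Selected s = ∃[ k ] Selecting k s × regs s 3 ≡ 0

  selectAll-correct : ∀ {s} → Selecting (2 + n + n) s →
                      Terminates selectAll s (3 + (2 + n + n) * 20) Selected
  selectAll-correct inv with while Selecting stop selecting-step (2 + n + n) inv
    where
      stop : ∀ {s} → Selecting 0 s → ¬ Holds (lit 0 ≺ reg 3) s
      stop inv 0<d = <⇒≱ 0<d (≤-trans (m≤m+n _ _) (Selecting.fuel inv))
  ... | s , t , run , t≤ , (k , inv′) , done = s , t , run , t≤ , k , inv′ , n≤0⇒n≡0 (≮⇒≥ done)

  module _ (split : IsSplit G) where

    output-correct : ∀ {s} → Selected s → Terminates (0 ≔ reg 5) s 2 (OutputsMaximumSTP G)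
    output-correct {s} (_ , inv , d≡0) = _ , _ , ⇓reg , ≤-refl , record
      { solution = partition
      ; written  = λ x → sym (toℕ-fromℕ< (cls<m x))
      ; optimal  = partition , upper-bound
      }
      where
        open GreedyOutcome split (Selecting.greedy inv)
          -- Every key is positive, so at key 0 all vertices have been visited.
          (λ u → inj₁ (subst (_< key u) (sym d≡0) z<s))

    -- The bound left open is inferred as the sum of the bounds of the phases, which `linear` spells
    -- out.
    total-correct : Terminates strongTransitivity (input L) _ (OutputsMaximumSTP G)
    total-correct =
      seq countDegrees-correct λ degs →
      seq (linkAll-correct degs) λ linked →
      seq (selecting-init linked) λ ready →
      seq (selectAll-correct ready) output-correct

theorem11 : MSTPLinearTimeOn IsSplit
theorem11 = strongTransitivity , 58 , λ {n} G split L →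
  let open Graph G using (∣E∣)
      open Correctness G L
      s , t , run , t≤ , correct = total-correct split
  in s , t , run , ≤-trans t≤ (linear n ∣E∣ (length entries) entries-length) , correct
  where
    linear : ∀ n e l → l ≤ e + e →
             4 + l * 14 + (3 + n * 18 + (4 + (3 + (2 + n + n) * 20 + 2))) ≤ 58 * (1 + n + e)
    linear n e l l≤ = begin
      4 + l * 14 + rest                    ≤⟨ +-monoˡ-≤ rest (+-monoʳ-≤ 4 (*-monoˡ-≤ 14 l≤)) ⟩
      -- The constant terms add up to 56, the coefficient of n to 18 + 40 = 58 and that of e to 28.
      -- The slack 2 + 30 e raises the first and the last to 58.
      4 + (e + e) * 14 + rest              ≤⟨ m≤m+n _ (2 + 30 * e) ⟩
      4 + (e + e) * 14 + rest + (2 + 30 * e) ≡⟨ expand n e ⟩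
      58 * (1 + n + e)                     ∎
      where
        open ≤-Reasoning
        rest = 3 + n * 18 + (4 + (3 + (2 + n + n) * 20 + 2))
        expand : ∀ n e → 4 + (e + e) * 14 + (3 + n * 18 + (4 + (3 + (2 + n + n) * 20 + 2))) + (2 + 30 * e)
                          ≡ 58 * (1 + n + e)
        expand = solve 2 (λ n e →
            con 4 :+ (e :+ e) :* con 14 :+ (con 3 :+ n :* con 18 :+ (con 4 :+ (con 3 :+ (con 2 :+ n :+ n) :* con 20 :+ con 2))) :+ (con 2 :+ con 30 :* e)
            := con 58 :* (con 1 :+ n :+ e)) refl
          where open +-*-Solver
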